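{- Let $\Gamma$ be a MaxSAT instance encoded with blocking variables, with $\mathrm{cost}(\Gamma)=k$, and let $A$ be the set of total assignments $\alpha$ with $\alpha\models\Gamma$ and $\mathrm{cost}(\alpha)=k$. Suppose (1) every two distinct assignments in $A$ have Hamming distance at least $d$, and (2) for every blocking variable $b$ there are $\alpha,\beta\in A$ with $\alpha(b)=0$ and $\beta(b)=1$. Then every derivation in the cost-SR calculus from $\Gamma$ that derives a unit clause $b$ for some blocking variable $b$ contains a clause $C$ introduced by the cost-SR rule whose witnessing substitution $\sigma$ satisfies $\mathrm{flip}(C,\sigma)\ge d$.
   Context: Literals, clauses, CNFs (multisets of clauses), $\mathrm{Var}(\Gamma)$. A substitution $\sigma$ maps each variable to $0$, $1$ or a literal, extended by $\sigma(\lnot x)=\lnot\sigma(x)$, $\sigma(0)=0$, $\sigma(1)=1$; $(\sigma\circ\tau)(x)=\sigma(\tau(x))$. A (partial) assignment has $\sigma(x)\in\{0,1,x\}$; total means all variables get Boolean values. $C{\upharpoonright}_\sigma$: apply $\sigma$ to each literal and simplify; $\sigma\models C$ if the result is $1$ or tautological; $\Gamma{\upharpoonright}_\sigma$ is the multiset of $C{\upharpoonright}_\sigma\neq1$ for $C\in\Gamma$. $\lnot C$ is the partial assignment falsifying all literals of $C$; $\tau\supseteq\rho$ means $\tau$ extends $\rho$. $\Gamma\vdash_1 C$ means unit propagation on $\Gamma{\upharpoonright}_{\lnot C}$ derives the empty clause; $\Gamma\vdash_1\Delta$ means $\Gamma\vdash_1 D$ for all $D\in\Delta$. A MaxSAT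 instance encoded with blocking variables is a CNF $\Gamma=H\cup\{C_1\lor b_1,\dots,C_m\lor b_m\}$ with distinct fresh variables $b_i$ (blocking variables). $\mathrm{cost}(\alpha)=\sum_i\alpha(b_i)$ for total $\alpha$; $\mathrm{cost}(\Gamma)=\min\{\mathrm{cost}(\alpha):\alpha\models\Gamma\}$. A clause $C$ is cost-SR w.r.t. $\Gamma$ via $\sigma$ if (1) $\Gamma{\upharpoonright}_{\lnot C}\vdash_1(\Gamma\cup\{C\}){\upharpoonright}_\sigma$ and (2) $\mathrm{cost}(\tau\circ\sigma)\le\mathrm{cost}(\tau)$ for all total $\tau\supseteq\lnot C$. A derivation in the cost-SR calculus from $\Gamma$ is a sequence $D_1,\dots,D_t$ where each $D_i$ is in $\Gamma$, or follows from earlier clauses by weakening or resolution, or is cost-SR (with an attached witnessing substitution) w.r.t. $\Gamma\cup\{D_1,\dots,D_{i-1}\}$ with $\mathrm{Var}(D_i)\subseteq\mathrm{Var}(\Gamma)$. For a clause $C$ derived by the cost-SR rule with witness $\sigma$, $\mathrm{flip}(C,\sigma)=\max_{\tau\supseteq\lnot C}\mathrm{HD}(\tau,\tau\circ\sigma)$ over total assignments $\tau$, where $\mathrm{HD}$ is the number of variables on which two total assignments differ. -}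

module Defs where

open import Data.Bool using (Bool; true; false; not; if_then_else_)
import Data.Bool.Properties as Bool
open import Data.Fin using (Fin)
import Data.Fin.Properties as Fin
open import Data.List using (List; []; _∷_; [_]; _++_; map; concatMap; mapMaybe; filter; length; allFin; tabulate; cartesianProductWith)
open import Data.List.Extrema.Nat using (max)
open import Data.List.Membership.Propositional using (_∈_; _∉_)
import Data.List.Membership.DecPropositional as DecMembership
open import Data.List.Relation.Binary.Subset.Propositional using (_⊆_)
open import Data.List.Relation.Unary.All using (All; all?)
open import Data.List.Relation.Unary.Any using (Any; any?)
import Data.Maybe as Maybe
open import Data.Maybe using (Maybe; just; nothing)
open import Data.Nat using (ℕ; zero; suc; _≤_)
open import Data.Nat.ListAction using (sum)
open import Data.Product using (_×_; _,_; ∃-syntax)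
open import Data.Sum using (_⊎_)
open import Data.Vec using (Vec; []; _∷_; lookup)
import Data.Vec as Vec
open import Function using (Injective)
open import Relation.Binary using (DecidableEquality)
open import Relation.Binary.PropositionalEquality using (_≡_; refl; cong)
open import Relation.Nullary using (Dec; yes; no; does; ¬_; ¬?; _×-dec_)
open import Relation.Nullary.Decidable using (map′)

private
  variable
    n : ℕ

-- The variables are the elements of Fin n; a CNF need not mention all of them.

data Lit (n : ℕ) : Set where
  pos neg : Fin n → Lit n

var : Lit n → Fin n
var (pos x) = x
var (neg x) = x

~_ : Lit n → Lit n
~ pos x = neg x
~ neg x = pos x

_≟ᴸ_ : DecidableEquality (Lit n)
pos x ≟ᴸ pos y = map′ (cong pos) (λ { refl → refl }) (x Fin.≟ y)
pos x ≟ᴸ neg y = no λ ()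
neg x ≟ᴸ pos y = no λ ()
neg x ≟ᴸ neg y = map′ (cong neg) (λ { refl → refl }) (x Fin.≟ y)

module _ {n : ℕ} where
  open DecMembership (_≟ᴸ_ {n}) public using () renaming (_∈?_ to _∈ᴸ?_)
  open DecMembership (Fin._≟_ {n}) public using () renaming (_∈?_ to _∈ⱽ?_)

-- A clause is a set of literals: two lists represent the same clause when they
-- are related by _≋_, and the proof rules below are stated up to _≋_.
-- A CNF is a multiset of clauses.

Clause : ℕ → Set
Clause n = List (Lit n)

CNF : ℕ → Set
CNF n = List (Clause n)

infix 4 _≋_
_≋_ : Clause n → Clause n → Set
C ≋ D = C ⊆ D × D ⊆ C

vars : Clause n → List (Fin n)
vars = map var

Var : CNF n → List (Fin n)
Var = concatMap vars

Tautological : Clause n → Set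
Tautological C = Any (λ ℓ → ~ ℓ ∈ C) C

tautological? : (C : Clause n) → Dec (Tautological C)
tautological? C = any? (λ ℓ → (~ ℓ) ∈ᴸ? C) C

data Value (n : ℕ) : Set where
  const : Bool → Value n
  lit   : Lit n → Value n

¬ⱽ_ : Value n → Value n
¬ⱽ const b = const (not b)
¬ⱽ lit ℓ   = lit (~ ℓ)

Subst : ℕ → Set
Subst n = Fin n → Value n

applyLit : Subst n → Lit n → Value n
applyLit σ (pos x) = σ x
applyLit σ (neg x) = ¬ⱽ σ x

applyValue : Subst n → Value n → Value n
applyValue σ (const b) = const b
applyValue σ (lit ℓ)   = applyLit σ ℓ

-- The result `nothing` stands for the constant 1.
infix 20 _↾ᶜ_ _↾_ _↾¬_
_↾ᶜ_ : Clause n → Subst n → Maybe (Clause n)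
[]      ↾ᶜ σ = just []
(ℓ ∷ C) ↾ᶜ σ with applyLit σ ℓ
... | const true  = nothing
... | const false = C ↾ᶜ σ
... | lit ℓ′      = Maybe.map (ℓ′ ∷_) (C ↾ᶜ σ)

_↾_ : CNF n → Subst n → CNF n
Γ ↾ σ = mapMaybe (_↾ᶜ σ) Γ

infix 4 _⊨ᶜ_ _⊨_
_⊨ᶜ_ : Subst n → Clause n → Set
σ ⊨ᶜ C = C ↾ᶜ σ ≡ nothing ⊎ (∃[ D ] (C ↾ᶜ σ ≡ just D × Tautological D))

Assignment : ℕ → Set
Assignment n = Vec Bool n

⌜_⌝ : Assignment n → Subst n
⌜ α ⌝ x = const (lookup α x)

_⊨_ : Assignment n → CNF n → Set
α ⊨ Γ = All (⌜ α ⌝ ⊨ᶜ_) Γ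

valueAt : Assignment n → Value n → Bool
valueAt τ (const b)     = b
valueAt τ (lit (pos x)) = lookup τ x
valueAt τ (lit (neg x)) = not (lookup τ x)

-- valueAt τ is applyValue ⌜ τ ⌝ read as a Boolean, so this is the composition
-- x ↦ τ (σ x).
infixr 9 _∘ˢ_
_∘ˢ_ : Assignment n → Subst n → Assignment n
τ ∘ˢ σ = Vec.tabulate (λ x → valueAt τ (σ x))

-- The partial assignment ¬C; used only for C that is not tautological.
negation : Clause n → Subst n
negation C x =
  if does (pos x ∈ᴸ? C) then const false
  else if does (neg x ∈ᴸ? C) then const true
  else lit (pos x)

-- If C is tautological then ¬C makes contradictory demands and no assignment
-- meets them; restricting by it is taken to give the contradictory CNF.
_↾¬_ : CNF n → Clause n → CNF n
Γ ↾¬ C = if does (tautological? C) then [ [] ] else Γ ↾ negation C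

-- τ ⊇ ¬C: the total assignment τ falsifies every literal of C (hence there is
-- no such τ when C is tautological).
infix 4 _⊇¬_ _⊇¬?_
_⊇¬_ : Assignment n → Clause n → Set
τ ⊇¬ C = All (λ ℓ → valueAt τ (lit ℓ) ≡ false) C

_⊇¬?_ : (τ : Assignment n) (C : Clause n) → Dec (τ ⊇¬ C)
τ ⊇¬? C = all? (λ ℓ → valueAt τ (lit ℓ) Bool.≟ false) C

setTrue : Lit n → Subst n
setTrue ℓ = negation [ ~ ℓ ]

-- Unit propagation on Γ derives the empty clause.
data UnitRefutes {n : ℕ} (Γ : CNF n) : Set where
  conflict  : [] ∈ Γ → UnitRefutes Γ
  propagate : ∀ {C} ℓ → C ∈ Γ → C ≋ [ ℓ ] → UnitRefutes (Γ ↾ setTrue ℓ) → UnitRefutes Γ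

infix 4 _⊢₁_ _⊢₁*_
_⊢₁_ : CNF n → Clause n → Set
Γ ⊢₁ C = UnitRefutes (Γ ↾¬ C)

_⊢₁*_ : CNF n → CNF n → Set
Γ ⊢₁* Δ = All (Γ ⊢₁_) Δ

record MaxSAT (n : ℕ) : Set where
  field
    hard            : CNF n
    m               : ℕ
    soft            : Fin m → Clause n
    block           : Fin m → Fin n
    block-injective : Injective _≡_ _≡_ block
    block-fresh-H   : ∀ i → block i ∉ Var hard
    block-fresh-C   : ∀ i j → block i ∉ vars (soft j)

  cnf : CNF n
  cnf = hard ++ tabulate (λ i → pos (block i) ∷ soft i)

  cost : Assignment n → ℕ
  cost α = sum (tabulate (λ i → if lookup α (block i) then 1 else 0))

open MaxSAT

HasCost : MaxSAT n → ℕ → Set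
HasCost Γ k =
  (∃[ α ] (α ⊨ cnf Γ × cost Γ α ≡ k)) ×
  (∀ α → α ⊨ cnf Γ → k ≤ cost Γ α)

-- Total assignments give values to the variables in a set X, in the theorem
-- X = Var(Γ).  They are represented by elements of Assignment n, of which only
-- the values on X matter: equality and Hamming distance are taken on X.

_≈[_]_ : Assignment n → List (Fin n) → Assignment n → Set
α ≈[ X ] β = ∀ {x} → x ∈ X → lookup α x ≡ lookup β x

HD : List (Fin n) → Assignment n → Assignment n → ℕ
HD {n} X α β = length (filter differs? (allFin n))
  where
  differs? : (x : Fin n) → Dec (x ∈ X × ¬ lookup α x ≡ lookup β x)
  differs? x = (x ∈ⱽ? X) ×-dec ¬? (lookup α x Bool.≟ lookup β x)

allAssignments : ∀ n → List (Assignment n)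
allAssignments zero    = [ [] ]
allAssignments (suc n) = cartesianProductWith _∷_ (false ∷ true ∷ []) (allAssignments n)

-- The maximum over the empty set (C tautological) is 0.
flip : List (Fin n) → Clause n → Subst n → ℕ
flip {n} X C σ =
  max 0 (map (λ τ → HD X τ (τ ∘ˢ σ)) (filter (_⊇¬? C) (allAssignments n)))

-- Clause C is cost-SR with respect to Δ via σ, for the cost function of Γ.
CostSR : MaxSAT n → CNF n → Clause n → Subst n → Set
CostSR Γ Δ C σ =
  (Δ ↾¬ C ⊢₁* (Δ ++ [ C ]) ↾ σ) ×
  (∀ τ → τ ⊇¬ C → cost Γ (τ ∘ˢ σ) ≤ cost Γ τ)

-- Step Γ Ds D: D can be added to a derivation whose earlier clauses are Ds.
-- In `resolution` the side clauses C and C′ are arbitrary.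
data Step {n : ℕ} (Γ : MaxSAT n) (Ds : List (Clause n)) (D : Clause n) : Set where
  initial    : ∀ {C} → C ∈ cnf Γ → D ≋ C → Step Γ Ds D
  weakening  : ∀ {C} → C ∈ Ds → C ⊆ D → Step Γ Ds D
  resolution : ∀ {E E′ C C′} x → E ∈ Ds → E′ ∈ Ds →
               E ≋ pos x ∷ C → E′ ≋ neg x ∷ C′ → D ≋ C ++ C′ → Step Γ Ds D
  costSR     : ∀ σ → vars D ⊆ Var (cnf Γ) → CostSR Γ (cnf Γ ++ Ds) D σ → Step Γ Ds D

-- Derivation Γ (Dₜ ∷ ⋯ ∷ D₁ ∷ []): the latest clause comes first.
data Derivation {n : ℕ} (Γ : MaxSAT n) : List (Clause n) → Set where
  []  : Derivation Γ []
  _▷_ : ∀ {D Ds} → Derivation Γ Ds → Step Γ Ds D → Derivation Γ (D ∷ Ds)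

infixl 5 _▷_

-- C is introduced in the derivation by the cost-SR rule with witness σ.
data Introduces {n : ℕ} {Γ : MaxSAT n} (C : Clause n) (σ : Subst n) :
                ∀ {Ds} → Derivation Γ Ds → Set where
  here  : ∀ {Ds} {π : Derivation Γ Ds}
          (v : vars C ⊆ Var (cnf Γ)) (r : CostSR Γ (cnf Γ ++ Ds) C σ) →
          Introduces C σ (π ▷ costSR σ v r)
  there : ∀ {D Ds} {π : Derivation Γ Ds} {s : Step Γ Ds D} →
          Introduces C σ π → Introduces C σ (π ▷ s)

Derives : (Ds : List (Clause n)) → Clause n → Set
Derives Ds C = Any (_≋ C) Ds

Optimal : MaxSAT n → ℕ → Assignment n → Set
Optimal Γ k α = α ⊨ cnf Γ × cost Γ α ≡ k

{-# OPTIONS --safe #-}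

-- Call a total assignment optimal when it satisfies Γ at cost k.  Unless some
-- cost-SR step flips at least d variables, every optimal assignment satisfies
-- every derived clause.  Initial clauses, weakening and resolution are sound.
-- If an optimal α falsifies a cost-SR clause C with witness σ, then condition
-- (1) makes α ∘ σ a model of Γ and C, and condition (2) makes it optimal; as it
-- satisfies C and α does not, the two differ on Var(Γ), hence in at least d
-- places, and flip(C, σ) ≥ d.  Finally, some optimal α has α(b) = 0, so it
-- falsifies the unit clause b.

module Submission where

open import Data.Bool using (true; false; not)
open import Data.Bool.Properties as Bool using (not-involutive; ¬-not)
open import Data.Fin using (Fin)
open import Data.List using (List; []; _∷_; [_]; _++_)
open import Data.List.Extrema.Nat using (xs≤max)
open import Data.List.Membership.Propositional using (_∈_; find; lose)
open import Data.List.Membership.Propositional.Properties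
  using (∈-cartesianProductWith⁺; ∈-filter⁺; ∈-map⁺)
open import Data.List.Relation.Binary.Subset.Propositional using (_⊆_)
open import Data.List.Relation.Binary.Subset.Propositional.Properties using (Any-resp-⊆)
open import Data.List.Relation.Unary.All as All using (All; []; _∷_)
open import Data.List.Relation.Unary.All.Properties using (¬Any⇒All¬; ++⁺; ++⁻ˡ; ++⁻ʳ; map⁺; mapMaybe⁺)
open import Data.List.Relation.Unary.Any using (Any; here; there; any?)
import Data.List.Relation.Unary.Any.Properties as Any
open import Data.Maybe using (just; nothing)
import Data.Maybe.Relation.Unary.All as Maybe
open import Data.Nat using (ℕ; _≤_; _≤?_)
open import Data.Nat.Properties using (≤-trans; ≤-antisym; ≤-reflexive)
open import Data.Product using (_×_; _,_; ∃-syntax; proj₂)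
open import Data.Sum using (_⊎_; inj₁; inj₂)
open import Data.Vec using ([]; _∷_; lookup)
open import Data.Vec.Properties using (lookup∘tabulate; tabulate∘lookup; tabulate-cong)
open import Relation.Binary.PropositionalEquality
  using (_≡_; refl; sym; trans; cong; subst)
open import Relation.Nullary using (¬_; Dec; yes; no; contradiction)
open import Relation.Nullary.Decidable using (decidable-stable)
open import Defs

private
  variable
    n : ℕ

-- Truth of a clause as a plain disjunction. The soundness arguments run on this notion; `⊨ᶜ` is
-- converted to and from it only where optimality is used or established.
Satisfies : Assignment n → Clause n → Set
Satisfies τ = Any (λ ℓ → valueAt τ (lit ℓ) ≡ true)

satisfies? : (τ : Assignment n) (C : Clause n) → Dec (Satisfies τ C)
satisfies? τ = any? (λ ℓ → valueAt τ (lit ℓ) Bool.≟ true)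

valueAt-¬ⱽ : (τ : Assignment n) (v : Value n) → valueAt τ (¬ⱽ v) ≡ not (valueAt τ v)
valueAt-¬ⱽ τ (const b)     = refl
valueAt-¬ⱽ τ (lit (pos x)) = refl
valueAt-¬ⱽ τ (lit (neg x)) = sym (not-involutive _)

valueAt-∘ˢ : (τ : Assignment n) (σ : Subst n) (ℓ : Lit n) →
             valueAt (τ ∘ˢ σ) (lit ℓ) ≡ valueAt τ (applyLit σ ℓ)
valueAt-∘ˢ τ σ (pos x) = lookup∘tabulate _ x
valueAt-∘ˢ τ σ (neg x) =
  trans (cong not (lookup∘tabulate _ x)) (sym (valueAt-¬ⱽ τ (σ x)))

valueAt-cong : (τ ρ : Assignment n) (ℓ : Lit n) →
               lookup τ (var ℓ) ≡ lookup ρ (var ℓ) →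
               valueAt τ (lit ℓ) ≡ valueAt ρ (lit ℓ)
valueAt-cong τ ρ (pos x) eq = eq
valueAt-cong τ ρ (neg x) eq = cong not eq

∘ˢ-fixed : (τ : Assignment n) (σ : Subst n) →
           (∀ x → valueAt τ (σ x) ≡ lookup τ x) → τ ∘ˢ σ ≡ τ
∘ˢ-fixed τ σ eq = trans (tabulate-cong eq) (tabulate∘lookup τ)

¬satisfies⇒⊇¬ : {τ : Assignment n} {C : Clause n} → ¬ Satisfies τ C → τ ⊇¬ C
¬satisfies⇒⊇¬ ¬s = All.map ¬-not (¬Any⇒All¬ _ ¬s)

⊇¬⇒¬satisfies : {τ : Assignment n} {C : Clause n} → τ ⊇¬ C → ¬ Satisfies τ C
⊇¬⇒¬satisfies (f ∷ fs) (here t)  = contradiction (trans (sym f) t) λ ()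
⊇¬⇒¬satisfies (f ∷ fs) (there s) = ⊇¬⇒¬satisfies fs s

-- A total assignment makes one of `ℓ` and `~ ℓ` true, and both lie in the clause.
tautological⇒satisfies : (τ : Assignment n) {C : Clause n} →
                         Tautological C → Satisfies τ C
tautological⇒satisfies τ taut with find taut
... | ℓ , ℓ∈C , ~ℓ∈C with valueAt τ (lit ℓ) in eq
...   | true  = lose ℓ∈C eq
...   | false = lose ~ℓ∈C (trans (valueAt-¬ⱽ τ (lit ℓ)) (cong not eq))

-- With its converse below, the substitution lemma: restricting by `σ` and evaluating at `τ` amounts
-- to evaluating at `τ ∘ˢ σ`. `Maybe.All` lets `nothing`, the constant 1, count as satisfied.
satisfies-↾ᶜ⁺ : (τ : Assignment n) (σ : Subst n) (C : Clause n) →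
                Satisfies (τ ∘ˢ σ) C → Maybe.All (Satisfies τ) (C ↾ᶜ σ)
satisfies-↾ᶜ⁺ τ σ (ℓ ∷ C) s with applyLit σ ℓ | valueAt-∘ˢ τ σ ℓ | s
... | const true  | _  | _       = Maybe.nothing
... | const false | eq | here t  = contradiction (trans (sym eq) t) λ ()
... | const false | _  | there t = satisfies-↾ᶜ⁺ τ σ C t
... | lit ℓ′      | eq | here t  with C ↾ᶜ σ
...   | nothing = Maybe.nothing
...   | just D  = Maybe.just (here (trans (sym eq) t))
satisfies-↾ᶜ⁺ τ σ (ℓ ∷ C) s
    | lit ℓ′      | _  | there t with C ↾ᶜ σ | satisfies-↾ᶜ⁺ τ σ C t
...   | nothing | _            = Maybe.nothing
...   | just D  | Maybe.just u = Maybe.just (there u)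

satisfies-↾ᶜ⁻ : (τ : Assignment n) (σ : Subst n) (C : Clause n) →
                Maybe.All (Satisfies τ) (C ↾ᶜ σ) → Satisfies (τ ∘ˢ σ) C
satisfies-↾ᶜ⁻ τ σ [] (Maybe.just ())
satisfies-↾ᶜ⁻ τ σ (ℓ ∷ C) s with applyLit σ ℓ | valueAt-∘ˢ τ σ ℓ
... | const true  | eq = here eq
... | const false | _  = there (satisfies-↾ᶜ⁻ τ σ C s)
... | lit ℓ′      | eq with C ↾ᶜ σ | satisfies-↾ᶜ⁻ τ σ C
...   | nothing | ih = there (ih Maybe.nothing)
...   | just D  | ih with s
...     | Maybe.just (here t)  = here (trans eq t)
...     | Maybe.just (there t) = there (ih (Maybe.just t))

satisfies-↾⁺ : (τ : Assignment n) (σ : Subst n) (Γ : CNF n) →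
               All (Satisfies (τ ∘ˢ σ)) Γ → All (Satisfies τ) (Γ ↾ σ)
satisfies-↾⁺ τ σ Γ s = mapMaybe⁺ (map⁺ (All.map (satisfies-↾ᶜ⁺ τ σ _) s))

satisfies-↾⁻ : (τ : Assignment n) (σ : Subst n) (Γ : CNF n) →
               All (Satisfies τ) (Γ ↾ σ) → All (Satisfies (τ ∘ˢ σ)) Γ
satisfies-↾⁻ τ σ []      _ = []
satisfies-↾⁻ τ σ (C ∷ Γ) s with C ↾ᶜ σ | satisfies-↾ᶜ⁻ τ σ C
... | nothing | r = r Maybe.nothing ∷ satisfies-↾⁻ τ σ Γ s
... | just D  | r with s
...   | t ∷ ts = r (Maybe.just t) ∷ satisfies-↾⁻ τ σ Γ ts

⊨ᶜ⇒satisfies : (α : Assignment n) (C : Clause n) → ⌜ α ⌝ ⊨ᶜ C → Satisfies α C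
⊨ᶜ⇒satisfies α C p =
  -- Composing `α` with itself, read as a substitution, gives `α` back, so the substitution lemma
  -- applies with `⌜ α ⌝` as `σ`.
  subst (λ ρ → Satisfies ρ C) (∘ˢ-fixed α ⌜ α ⌝ λ _ → refl)
    (satisfies-↾ᶜ⁻ α ⌜ α ⌝ C (restricted p))
  where
  restricted : ⌜ α ⌝ ⊨ᶜ C → Maybe.All (Satisfies α) (C ↾ᶜ ⌜ α ⌝)
  restricted (inj₁ eq) rewrite eq = Maybe.nothing
  restricted (inj₂ (D , eq , taut)) rewrite eq = Maybe.just (tautological⇒satisfies α taut)

-- A total assignment sends every literal to a constant, so a true literal turns the whole
-- restriction into 1 and the first alternative of `⊨ᶜ` holds.
satisfies⇒⊨ᶜ : (α : Assignment n) (C : Clause n) → Satisfies α C → ⌜ α ⌝ ⊨ᶜ C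
satisfies⇒⊨ᶜ α C s = inj₁ (restricts-to-1 C s)
  where
  restricts-to-1 : ∀ C → Satisfies α C → C ↾ᶜ ⌜ α ⌝ ≡ nothing
  restricts-to-1 (pos x ∷ C) s with lookup α x in eq | s
  ... | true  | _       = refl
  ... | false | here t  = contradiction (trans (sym eq) t) λ ()
  ... | false | there t = restricts-to-1 C t
  restricts-to-1 (neg x ∷ C) s with lookup α x in eq | s
  ... | false | _       = refl
  ... | true  | here t  = contradiction (trans (sym (cong not eq)) t) λ ()
  ... | true  | there t = restricts-to-1 C t

-- The partial assignment `negation C` fixes only values that `τ` already has. Hence restricting by
-- it keeps `τ` a model.
∘ˢ-negation : (τ : Assignment n) (C : Clause n) → τ ⊇¬ C → τ ∘ˢ negation C ≡ τ
∘ˢ-negation τ C f = ∘ˢ-fixed τ (negation C) agrees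
  where
  agrees : ∀ x → valueAt τ (negation C x) ≡ lookup τ x
  agrees x with pos x ∈ᴸ? C
  ... | yes p = sym (All.lookup f p)
  ... | no _  with neg x ∈ᴸ? C
  ...   | yes q = sym (trans (sym (not-involutive _)) (cong not (All.lookup f q)))
  ...   | no _  = refl

satisfies-negation : (τ : Assignment n) (C : Clause n) (Γ : CNF n) → τ ⊇¬ C →
                     All (Satisfies τ) Γ → All (Satisfies τ) (Γ ↾ negation C)
satisfies-negation τ C Γ f s = satisfies-↾⁺ τ (negation C) Γ
  (subst (λ ρ → All (Satisfies ρ) Γ) (sym (∘ˢ-negation τ C f)) s)

satisfies-↾¬ : (τ : Assignment n) (C : Clause n) (Γ : CNF n) → τ ⊇¬ C →
               All (Satisfies τ) Γ → All (Satisfies τ) (Γ ↾¬ C)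
satisfies-↾¬ τ C Γ f s with tautological? C
-- No assignment falsifies a tautology, so the branch in which `↾¬` returns the contradictory CNF
-- cannot occur.
... | yes taut = contradiction (tautological⇒satisfies τ taut) (⊇¬⇒¬satisfies f)
... | no _     = satisfies-negation τ C Γ f s

-- A model makes every unit literal true, so it survives each propagation and never meets the empty
-- clause.
unitRefutes-sound : (τ : Assignment n) {Γ : CNF n} →
                    UnitRefutes Γ → ¬ All (Satisfies τ) Γ
unitRefutes-sound τ (conflict []∈Γ) s with () ← All.lookup s []∈Γ
unitRefutes-sound τ {Γ} (propagate ℓ C∈Γ (C⊆ℓ , _) r) s =
  -- `setTrue ℓ` is by definition `negation [ ~ ℓ ]`, so the lemma on `negation` covers propagation
  -- once `~ ℓ` is false.
  unitRefutes-sound τ r (satisfies-negation τ [ ~ ℓ ] Γ (~ℓ-false ∷ []) s)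
  where
  ℓ-true : valueAt τ (lit ℓ) ≡ true
  ℓ-true = Any.singleton⁻ (Any-resp-⊆ C⊆ℓ (All.lookup s C∈Γ))
  ~ℓ-false : valueAt τ (lit (~ ℓ)) ≡ false
  ~ℓ-false = trans (valueAt-¬ⱽ τ (lit ℓ)) (cong not ℓ-true)

-- Otherwise `τ` would falsify `C` and so be a model of the refuted CNF `Γ ↾¬ C`.
⊢₁-sound : (τ : Assignment n) (Γ : CNF n) (C : Clause n) →
           Γ ⊢₁ C → All (Satisfies τ) Γ → Satisfies τ C
⊢₁-sound τ Γ C r s with satisfies? τ C
... | yes t = t
... | no ¬t =
  contradiction (satisfies-↾¬ τ C Γ (¬satisfies⇒⊇¬ ¬t) s) (unitRefutes-sound τ r)

resolution-sound : (τ : Assignment n) (x : Fin n) (C C′ : Clause n) →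
                   Satisfies τ (pos x ∷ C) → Satisfies τ (neg x ∷ C′) →
                   Satisfies τ (C ++ C′)
resolution-sound τ x C C′ (there s) _         = Any.++⁺ˡ s
resolution-sound τ x C C′ _         (there t) = Any.++⁺ʳ C t
resolution-sound τ x C C′ (here s)  (here t)  =
  contradiction (trans (sym t) (cong not s)) λ ()

∈-allAssignments : (τ : Assignment n) → τ ∈ allAssignments n
∈-allAssignments []      = here refl
∈-allAssignments (b ∷ τ) = ∈-cartesianProductWith⁺ _∷_ (∈-bools b) (∈-allAssignments τ)
  where
  ∈-bools : ∀ b → b ∈ (false ∷ true ∷ [])
  ∈-bools false = here refl
  ∈-bools true  = there (here refl)

HD≤flip : (X : List (Fin n)) (C : Clause n) (σ : Subst n) (τ : Assignment n) →
          τ ⊇¬ C → HD X τ (τ ∘ˢ σ) ≤ flip X C σ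
HD≤flip X C σ τ f =
  All.lookup (xs≤max 0 _)
    (∈-map⁺ (λ τ → HD X τ (τ ∘ˢ σ)) (∈-filter⁺ (_⊇¬? C) (∈-allAssignments τ) f))

-- The semantic content of condition (1): `τ` satisfies `Δ ↾¬ C`, hence by soundness of unit
-- propagation also `(Δ ++ [ C ]) ↾ σ`, and the substitution lemma moves `σ` over to the assignment.
costSR-satisfies : (Γ : MaxSAT n) {Δ : CNF n} {C : Clause n} {σ : Subst n} →
                   CostSR Γ Δ C σ → (τ : Assignment n) → τ ⊇¬ C →
                   All (Satisfies τ) Δ → All (Satisfies (τ ∘ˢ σ)) (Δ ++ [ C ])
costSR-satisfies Γ {Δ} {C} {σ} (r , _) τ f s =
  satisfies-↾⁻ τ σ (Δ ++ [ C ])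
    (All.map (λ p → ⊢₁-sound τ (Δ ↾¬ C) _ p (satisfies-↾¬ τ C Δ f s)) r)

-- Agreement on `X` gives every literal of `C` the same value, because the variables of `C` lie in
-- `X`. The variable restriction of the cost-SR rule enters here.
falsified⇒≉ : {X : List (Fin n)} {C : Clause n} (τ ρ : Assignment n) → vars C ⊆ X →
              τ ⊇¬ C → Satisfies ρ C → ¬ (τ ≈[ X ] ρ)
falsified⇒≉ τ ρ v f s τ≈ρ with find s
... | ℓ , ℓ∈C , t = contradiction
  (trans (sym (All.lookup f ℓ∈C)) (trans (valueAt-cong τ ρ ℓ (τ≈ρ (v (∈-map⁺ var ℓ∈C)))) t))
  λ ()

module _ {n : ℕ} (Γ : MaxSAT n) (k d : ℕ) where
  open MaxSAT Γ

  optimal-satisfies : ∀ {α} → Optimal Γ k α → All (Satisfies α) cnf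
  optimal-satisfies (α⊨Γ , _) = All.map (⊨ᶜ⇒satisfies _ _) α⊨Γ

  LargeFlip : ∀ {Ds} → Derivation Γ Ds → Set
  LargeFlip π = ∃[ C ] ∃[ σ ] (Introduces C σ π × d ≤ flip (Var cnf) C σ)

  module _
    (k-lower : ∀ α → α ⊨ cnf → k ≤ cost α)
    (separated : ∀ α β → Optimal Γ k α → Optimal Γ k β →
                 ¬ (α ≈[ Var cnf ] β) → d ≤ HD (Var cnf) α β)
    where

    falsified⇒large-flip : ∀ {Ds C σ α} → vars C ⊆ Var cnf → CostSR Γ (cnf ++ Ds) C σ →
                           Optimal Γ k α → All (Satisfies α) Ds → α ⊇¬ C →
                           d ≤ flip (Var cnf) C σ
    falsified⇒large-flip {Ds} {C} {σ} {α} v r opt s f =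
      ≤-trans (separated α (α ∘ˢ σ) opt opt′ (falsified⇒≉ α (α ∘ˢ σ) v f satC))
              (HD≤flip (Var cnf) C σ α f)
      where
      sat : All (Satisfies (α ∘ˢ σ)) ((cnf ++ Ds) ++ [ C ])
      sat = costSR-satisfies Γ {cnf ++ Ds} r α f (++⁺ (optimal-satisfies opt) s)
      satC : Satisfies (α ∘ˢ σ) C
      satC = All.head (++⁻ʳ (cnf ++ Ds) sat)
      models : (α ∘ˢ σ) ⊨ cnf
      models = All.map (satisfies⇒⊨ᶜ (α ∘ˢ σ) _) (++⁻ˡ cnf (++⁻ˡ (cnf ++ Ds) sat))
      opt′ : Optimal Γ k (α ∘ˢ σ)
      -- Condition (2) bounds the cost by `k` from above, minimality of `k` among models from below.
      opt′ = models , ≤-antisym (≤-trans (proj₂ r α f) (≤-reflexive (proj₂ opt)))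
                                (k-lower (α ∘ˢ σ) models)

    optimal-satisfies-step : ∀ {Ds D} (π : Derivation Γ Ds) (st : Step Γ Ds D) →
                             (∀ α → Optimal Γ k α → All (Satisfies α) Ds) →
                             LargeFlip (π ▷ st) ⊎ (∀ α → Optimal Γ k α → Satisfies α D)
    optimal-satisfies-step π (initial C∈Γ (_ , C⊆D)) inv =
      inj₂ λ α opt → Any-resp-⊆ C⊆D (All.lookup (optimal-satisfies opt) C∈Γ)
    optimal-satisfies-step π (weakening C∈Ds C⊆D) inv =
      inj₂ λ α opt → Any-resp-⊆ C⊆D (All.lookup (inv α opt) C∈Ds)
    optimal-satisfies-step π
      (resolution {C = C} {C′ = C′} x E∈Ds E′∈Ds (E⊆ , _) (E′⊆ , _) (_ , ⊆D)) inv =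
      inj₂ λ α opt → Any-resp-⊆ ⊆D
        (resolution-sound α x C C′
          (Any-resp-⊆ E⊆ (All.lookup (inv α opt) E∈Ds))
          (Any-resp-⊆ E′⊆ (All.lookup (inv α opt) E′∈Ds)))
    optimal-satisfies-step {D = D} π (costSR σ v r) inv with d ≤? flip (Var cnf) D σ
    ... | yes d≤flip = inj₁ (D , σ , here v r , d≤flip)
    ... | no  d≰flip = inj₂ λ α opt → decidable-stable (satisfies? α D) λ ¬s →
      d≰flip (falsified⇒large-flip v r opt (inv α opt) (¬satisfies⇒⊇¬ ¬s))

    optimal-satisfies-derived : ∀ {Ds} (π : Derivation Γ Ds) →
                                LargeFlip π ⊎ (∀ α → Optimal Γ k α → All (Satisfies α) Ds)
    optimal-satisfies-derived [] = inj₂ λ _ _ → []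
    optimal-satisfies-derived (π ▷ st) with optimal-satisfies-derived π
    ... | inj₁ (C , σ , intro , d≤flip) = inj₁ (C , σ , there intro , d≤flip)
    ... | inj₂ inv with optimal-satisfies-step π st inv
    ...   | inj₁ large = inj₁ large
    ...   | inj₂ sat   = inj₂ λ α opt → sat α opt ∷ inv α opt

theorem5p1 :
    ∀ {n : ℕ} (Γ : MaxSAT n) (k d : ℕ) →
    let open MaxSAT Γ
        X = Var cnf
    in
    HasCost Γ k →
    (∀ α β → Optimal Γ k α → Optimal Γ k β → ¬ (α ≈[ X ] β) → d ≤ HD X α β) →
    (∀ (i : Fin m) → (∃[ α ] (Optimal Γ k α × lookup α (block i) ≡ false)) ×
                     (∃[ β ] (Optimal Γ k β × lookup β (block i) ≡ true))) →
    ∀ {Ds} (π : Derivation Γ Ds) (i : Fin m) → Derives Ds [ pos (block i) ] →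
    ∃[ C ] ∃[ σ ] (Introduces C σ π × d ≤ flip X C σ)
theorem5p1 Γ k d (_ , k-lower) separated both π i derived
  with optimal-satisfies-derived Γ k d k-lower separated π | both i
... | inj₁ large | _ = large
... | inj₂ inv   | (α , opt , b-false) , _ with find derived
...   | D , D∈Ds , (D⊆b , _) =
  -- The derived clause equals the unit clause only up to `≋`, so its true literal is first carried
  -- over to `[ pos (block i) ]`.
  contradiction (Any-resp-⊆ D⊆b (All.lookup (inv α opt) D∈Ds))
                (⊇¬⇒¬satisfies (b-false ∷ []))
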